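{- Let $U$ be the class of all algorithms (in the Random Access Machine model), let $H\subseteq U$ be the class of homogeneous algorithms and let $NH\subseteq U$ be the class of non homogeneous algorithms. Then $H$ and $NH$ partition $U$ into two non-empty disjoint subclasses, that is, $$H\cap NH=\emptyset,\qquad H\cup NH=U,\qquad H\neq\emptyset,\qquad NH\neq\emptyset .$$
   Context: Computational model: algorithms are considered in the Random Access Machine (RAM) model, in which every elementary operation (addition, subtraction, multiplication, division or comparison of two numbers, reading or writing a number in memory, accessing an element of an array, calling a function, etc.) is executed in constant time, i.e. in time $\Theta(1)$ (bounded above and below by positive constants). The time taken by an algorithm on an input is the total time of the elementary operations it executes. Asymptotic notation: all functions are positive functions of a positive integer $n$ (they denote time, and $n$ is the dimension of the problem). For a function $g(n)$, $\Theta(g(n))$ denotes the set of functions $t(n)$ for which there exist constants $a>0$, $b>0$ and a positive integer $n_0$ such that $b\,g(n)\le t(n)\le a\,g(n)$ for every $n\ge n_0$. Problems and running times: a computational problem has, for each dimension $n$, a non-empty set $I(n)$ of instances of dimension $n$. If $A$ is an algorithm solving the problem, $t_A(i,n)>0$ denotes the time taken by $A$ to solve the instance $i\in I(n)$. Let $S=\{t_A(i,n): i\in I(n)\}$ be the set of time functions of $A$; its elements are the functions $n\mapsto t_A(i_n,n)$ obtained from a choice of an instance $i_n\in I(n)$ for each $n$. Definition: an algorithm $A$ (solving a given computational problem) is homogeneous if there exists a function $g(n)$ such that $S\subseteq\Theta(g(n))$. Otherwise it is non homogeneous.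
   Formalization: The times of elementary operations, the time functions, the function g and the constants a, b in Θ are rational rather than real; the numbers handled by the machine are read as integers, as usual for a RAM. -}

module Defs where

open import Data.Bool using (Bool; if_then_else_)
open import Data.Fin using (toℕ)
open import Data.Integer using (ℤ; +_; -[1+_]; +[1+_]; 0ℤ)
import Data.Integer as ℤ
open import Data.List using (List; []; _∷_; length; lookup)
open import Data.Maybe using (Maybe; just; nothing) renaming (map to mapMaybe)
open import Data.Nat using (ℕ; zero; suc; NonZero)
import Data.Nat as ℕ
open import Data.Product using (Σ-syntax; ∃; ∃-syntax; _×_; _,_; proj₁; proj₂)
open import Data.Rational using (ℚ; 0ℚ; _+_; _*_; _≤_; _<_)
open import Data.Rational.Properties using (<-≤-trans; +-mono-<)
open import Level using (0ℓ)
open import Relation.Binary.PropositionalEquality using (_≡_)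
open import Relation.Nullary using (¬_; does)
open import Relation.Unary using (Pred; _∈_; _⊆_; Satisfiable)

-- Random access machines over the integers.  The machine has registers, which
-- are addressed directly, and a memory (a single unbounded array), which is
-- addressed through the contents of registers.

Register Label : Set
Register = ℕ
Label    = ℕ

data ArithOp : Set where
  add sub mul div : ArithOp

data Comparison : Set where
  eq lt le : Comparison

data Instr : Set where
  const  : (dst : Register) (value : ℤ) → Instr
  move   : (dst src : Register) → Instr
  arith  : (op : ArithOp) (dst src₁ src₂ : Register) → Instr
  load   : (dst address : Register) → Instr
  store  : (address src : Register) → Instr
  jump   : (target : Label) → Instr
  branch : (cmp : Comparison) (src₁ src₂ : Register) (target : Label) → Instr
  call   : (target : Label) → Instr
  return : Instr
  halt   : Instr

Program : Set
Program = List Instr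

-- A label is a position in the program; running past the end halts.

fetch : Program → Label → Instr
fetch []       _       = halt
fetch (i ∷ _)  zero    = i
fetch (_ ∷ is) (suc l) = fetch is l

record Config : Set where
  constructor config
  field
    pc    : Label
    stack : List Label   -- pending return addresses
    reg   : Register → ℤ
    mem   : ℕ → ℤ

open Config public

_[_≔_] : (ℕ → ℤ) → ℕ → ℤ → (ℕ → ℤ)
(f [ k ≔ x ]) j = if does (j ℕ.≟ k) then x else f j

-- Integer division with remainder; undefined for divisor zero.

divide : ℤ → ℤ → Maybe ℤ
divide x (+ zero)       = nothing
divide x y@(+[1+ _ ])   = just (x ℤ./ y)
divide x y@(-[1+ _ ])   = just (x ℤ./ y)

evalArith : ArithOp → ℤ → ℤ → Maybe ℤ
evalArith add x y = just (x ℤ.+ y)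
evalArith sub x y = just (x ℤ.- y)
evalArith mul x y = just (x ℤ.* y)
evalArith div x y = divide x y

compare : Comparison → ℤ → ℤ → Bool
compare eq x y = does (x ℤ.≟ y)
compare lt x y = does (x ℤ.<? y)
compare le x y = does (x ℤ.≤? y)

toAddress : ℤ → Maybe ℕ
toAddress (+ a)    = just a
toAddress -[1+ _ ] = nothing

-- `stuck` is a run-time error (division by zero, negative address, return
-- without a call); a run that gets stuck does not terminate in the sense of
-- _⊢_⇓_ below.

data Outcome : Set where
  next   : Config → Outcome
  halted : Outcome
  stuck  : Outcome

setReg : Register → Maybe ℤ → Config → Outcome
setReg dst nothing  c = stuck
setReg dst (just x) c = next (record c { pc = suc (pc c) ; reg = reg c [ dst ≔ x ] })

setMem : Maybe ℕ → ℤ → Config → Outcome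
setMem nothing  x c = stuck
setMem (just a) x c = next (record c { pc = suc (pc c) ; mem = mem c [ a ≔ x ] })

goto : Label → Config → Outcome
goto l c = next (record c { pc = l })

popStack : List Label → Config → Outcome
popStack []       c = stuck
popStack (l ∷ ls) c = next (record c { pc = l ; stack = ls })

exec : Instr → Config → Outcome
exec (const d x)      c = setReg d (just x) c
exec (move d s)       c = setReg d (just (reg c s)) c
exec (arith op d s t) c = setReg d (evalArith op (reg c s) (reg c t)) c
exec (load d a)       c = setReg d (mapMaybe (mem c) (toAddress (reg c a))) c
exec (store a s)      c = setMem (toAddress (reg c a)) (reg c s) c
exec (jump l)         c = goto l c
exec (branch p s t l) c =
  goto (if compare p (reg c s) (reg c t) then l else suc (pc c)) c
exec (call l)         c = next (record c { pc = l ; stack = suc (pc c) ∷ stack c })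
exec return           c = popStack (stack c) c
exec halt             c = halted

data _⊢_⇓_ (P : Program) : Config → Config → Set where
  stop : ∀ {c} → exec (fetch P (pc c)) c ≡ halted → P ⊢ c ⇓ c
  step : ∀ {c c′ d} → exec (fetch P (pc c)) c ≡ next c′ → P ⊢ c′ ⇓ d → P ⊢ c ⇓ d

-- A finite sequence of numbers is presented in the first cells of the memory,
-- with its length in register 0.  All other cells and registers start at 0.

cells : List ℤ → ℕ → ℤ
cells []       _       = 0ℤ
cells (x ∷ _)  zero    = x
cells (_ ∷ xs) (suc a) = cells xs a

initial : List ℤ → Config
initial xs = config 0 [] ((λ _ → 0ℤ) [ 0 ≔ + length xs ]) (cells xs)

Presents : Config → List ℤ → Set
Presents c xs = reg c 0 ≡ + length xs × (∀ j → mem c (toℕ j) ≡ lookup xs j)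

-- Each instruction comprises a fixed number of elementary operations, so
-- its execution takes time Θ(1): the time may vary with the instruction and
-- with the configuration, between two positive constants.

record CostModel : Set where
  field
    cost        : Instr → Config → ℚ
    lower upper : ℚ
    0<lower     : 0ℚ < lower
    lower≤cost  : ∀ i c → lower ≤ cost i c
    cost≤upper  : ∀ i c → cost i c ≤ upper

  0<cost : ∀ i c → 0ℚ < cost i c
  0<cost i c = <-≤-trans 0<lower (lower≤cost i c)

  runTime : ∀ {P c d} → P ⊢ c ⇓ d → ℚ
  runTime {P} {c} (stop _)   = cost (fetch P (pc c)) c
  runTime {P} {c} (step _ r) = cost (fetch P (pc c)) c + runTime r

  0<runTime : ∀ {P c d} (r : P ⊢ c ⇓ d) → 0ℚ < runTime r
  0<runTime {P} {c} (stop _)   = 0<cost (fetch P (pc c)) c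
  0<runTime {P} {c} (step _ r) = +-mono-< (0<cost (fetch P (pc c)) c) (0<runTime r)

-- `Solution n xs ys` says that ys is a correct output for the instance xs of
-- dimension n.

record Problem : Set₁ where
  field
    Instance  : ∀ n → .{{NonZero n}} → Pred (List ℤ) 0ℓ
    nonEmpty  : ∀ n → .{{_ : NonZero n}} → Satisfiable (Instance n)
    Solution  : ∀ n → .{{NonZero n}} → List ℤ → Pred (List ℤ) 0ℓ

record Algorithm : Set₁ where
  field
    problem : Problem
    program : Program

  open Problem problem public

  field
    solves : ∀ n .{{_ : NonZero n}} xs → xs ∈ Instance n →
             ∃[ d ] (program ⊢ initial xs ⇓ d) ×
                    (∃[ ys ] Presents d ys × ys ∈ Solution n xs)

record PositiveFunction : Set where
  field
    fun      : (n : ℕ) → .{{NonZero n}} → ℚ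
    positive : ∀ n .{{_ : NonZero n}} → 0ℚ < fun n

open PositiveFunction public

Θ : PositiveFunction → Pred PositiveFunction 0ℓ
Θ g t = ∃[ a ] ∃[ b ] ∃[ n₀ ] 0ℚ < a × 0ℚ < b × NonZero n₀ ×
        (∀ n .{{_ : NonZero n}} → n₀ ℕ.≤ n → b * fun g n ≤ fun t n × fun t n ≤ a * fun g n)

module _ (κ : CostModel) where

  open CostModel κ

  time : (A : Algorithm) (let open Algorithm A) →
         ∀ n .{{_ : NonZero n}} → ∃ (Instance n) → ℚ
  time A n (xs , xs∈I) = runTime (proj₁ (proj₂ (Algorithm.solves A n xs xs∈I)))

  timeFunction : (A : Algorithm) →
                 (∀ n → .{{_ : NonZero n}} → ∃ (Algorithm.Instance A n)) →
                 PositiveFunction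
  timeFunction A i = record
    { fun      = λ n → time A n (i n)
    ; positive = λ n → 0<runTime (proj₁ (proj₂ (Algorithm.solves A n _ (proj₂ (i n)))))
    }

  TimeFunctions : Algorithm → Pred PositiveFunction 0ℓ
  TimeFunctions A t =
    Σ[ i ∈ (∀ n → .{{_ : NonZero n}} → ∃ (Algorithm.Instance A n)) ]
      (∀ n .{{_ : NonZero n}} → fun t n ≡ fun (timeFunction A i) n)

  Homogeneous : Pred Algorithm 0ℓ
  Homogeneous A = ∃[ g ] TimeFunctions A ⊆ Θ g

  NonHomogeneous : Pred Algorithm 0ℓ
  NonHomogeneous A = ¬ Homogeneous A

{-# OPTIONS --safe #-}

-- Halting at once takes time Θ(1) on every instance, so the empty program is
-- homogeneous.  Counting the length of the input down to zero takes a constant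
-- time on the empty sequence and at least n·lower on a sequence of length n.
-- When both are instances of dimension n, no single Θ(g) contains both time
-- functions: it would give b·n·lower ≤ a·K for all large n, with constants a,
-- b > 0 and K, against the Archimedean property of ℚ.

module Submission where

open import Defs
open import Axiom.ExcludedMiddle using (ExcludedMiddle)
open import Data.Product using (_×_)
open import Level using (0ℓ)
open import Relation.Unary using (_∩_; _∪_; _≐_; ∅; U; Satisfiable)

open import Algebra.Bundles using (CommutativeRing)
import Algebra.Properties.Semiring.Mult as Mult
open import Data.Bool using (if_then_else_)
open import Data.Fin using (toℕ; zero; suc)
open import Data.Integer using (+_; -[1+_]; 0ℤ; 1ℤ)
import Data.Integer as ℤ
import Data.Integer.Properties as ℤₚ
open import Data.List using ([]; _∷_; length; lookup; replicate)
open import Data.List.Properties using (length-replicate)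
open import Data.Nat using (ℕ; zero; suc; NonZero; z≤n; s≤s)
import Data.Nat as ℕ
import Data.Nat.Properties as ℕₚ
open import Data.Product using (∃; ∃-syntax; Σ-syntax; _,_; proj₁; proj₂)
open import Data.Rational
  using (0ℚ; 1ℚ; _*_; _≤_; _<_; toℚᵘ; 1/_; nonNegative; ↥_; ↧_)
import Data.Rational as ℚ
open import Data.Rational.Properties
import Data.Rational.Unnormalised as ℚᵘ
import Data.Rational.Unnormalised.Properties as ℚᵘₚ
open import Relation.Binary.PropositionalEquality
  using (_≡_; refl; sym; cong; cong₂; subst)
open import Relation.Nullary using (¬_)
open import Relation.Nullary.Decidable using (toSum)

open Mult (CommutativeRing.semiring +-*-commutativeRing)
  using (×-comm-*; ×-assoc-*) renaming (_×_ to _·_)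

·-monoˡ-≤ : ∀ {p} → 0ℚ ≤ p → ∀ {m n} → m ℕ.≤ n → m · p ≤ n · p
·-monoˡ-≤ 0≤p {n = zero}  z≤n       = ≤-refl
·-monoˡ-≤ 0≤p {n = suc n} z≤n       = +-mono-≤ 0≤p (·-monoˡ-≤ 0≤p {n = n} z≤n)
·-monoˡ-≤ {p} 0≤p         (s≤s m≤n) = +-monoʳ-≤ p (·-monoˡ-≤ 0≤p m≤n)

-- Unnormalised fractions avoid reduction by gcds: the multiple keeps the literal numerator `n` over
-- 1.
toℚᵘ-·1 : ∀ n → toℚᵘ (n · 1ℚ) ℚᵘ.≃ ℚᵘ.mkℚᵘ (+ n) 0
toℚᵘ-·1 zero    = ℚᵘₚ.≃-refl
toℚᵘ-·1 (suc n) =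
  ℚᵘₚ.≃-trans (toℚᵘ-homo-+ 1ℚ (n · 1ℚ))
    (ℚᵘₚ.≃-trans (ℚᵘₚ.+-congʳ (toℚᵘ 1ℚ) (toℚᵘ-·1 n))
      (ℚᵘ.*≡* (cong (ℤ._* 1ℤ) (cong (ℤ._+_ 1ℤ) (ℤₚ.*-identityʳ (+ n))))))

i<1+∣i∣ : ∀ i → i ℤ.< + suc ℤ.∣ i ∣
i<1+∣i∣ (+ n)    = ℤ.+<+ ℕₚ.≤-refl
i<1+∣i∣ -[1+ n ] = ℤ.-<+

archimedean-1 : ∀ q → ∃[ n ] q < n · 1ℚ
archimedean-1 q = n , toℚᵘ-cancel-< (ℚᵘₚ.<-respʳ-≃ (ℚᵘₚ.≃-sym (toℚᵘ-·1 n)) (q<n q))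
  where
  -- The denominator is at least 1, so any natural number above the numerator exceeds `q`.
  n = suc ℤ.∣ ↥ q ∣
  open ℤₚ.≤-Reasoning
  q<n : ∀ q → toℚᵘ q ℚᵘ.< ℚᵘ.mkℚᵘ (+ suc ℤ.∣ ↥ q ∣) 0
  q<n q@record{} = ℚᵘ.*<* (begin-strict
    ↥ q ℤ.* 1ℤ                ≡⟨ ℤₚ.*-identityʳ (↥ q) ⟩
    ↥ q                       <⟨ i<1+∣i∣ (↥ q) ⟩
    + suc ℤ.∣ ↥ q ∣           ≤⟨ ℤ.+≤+ (ℕₚ.m≤m*n (suc ℤ.∣ ↥ q ∣) _) ⟩
    + suc ℤ.∣ ↥ q ∣ ℤ.* ↧ q   ∎)

-- The unit case at `q * 1/ p`, scaled by `p`.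
archimedean : ∀ {p} → 0ℚ < p → ∀ q → ∃[ n ] q < n · p
archimedean {p} 0<p q = n , (begin-strict
  q                  ≡⟨ *-identityʳ q ⟨
  q * 1ℚ             ≡⟨ cong (q *_) (*-inverseˡ p) ⟨
  q * (1/ p * p)     ≡⟨ *-assoc q (1/ p) p ⟨
  q * 1/ p * p       <⟨ *-monoˡ-<-pos p (proj₂ (archimedean-1 (q * 1/ p))) ⟩
  (n · 1ℚ) * p       ≡⟨ ×-assoc-* n 1ℚ p ⟩
  n · (1ℚ * p)       ≡⟨ cong (n ·_) (*-identityˡ p) ⟩
  n · p              ∎)
  where
  open ≤-Reasoning
  instance
    p-pos     = ℚ.positive 0<p
    p-nonZero = pos⇒nonZero p
  n = proj₁ (archimedean-1 (q * 1/ p))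

*-pos : ∀ {p q} → 0ℚ < p → 0ℚ < q → 0ℚ < p * q
*-pos {p} {q} 0<p 0<q =
  subst (_< p * q) (*-zeroˡ q) (*-monoˡ-<-pos q {{ℚ.positive 0<q}} 0<p)

-- Eliminates `g`: the upper constant `a` of `t` and the lower constant `b` of `s` give b·t ≤ b·a·g
-- ≤ a·s beyond both thresholds.
Θ-comparable : ∀ g s t → Θ g s → Θ g t →
               ∃[ a ] ∃[ b ] ∃[ n₀ ] 0ℚ < a × 0ℚ < b × NonZero n₀ ×
               (∀ n .{{_ : NonZero n}} → n₀ ℕ.≤ n → b * fun t n ≤ a * fun s n)
Θ-comparable g s t (_ , b , m , _ , 0<b , _ , s-Θ) (a , _ , n₀ , 0<a , _ , n₀≢0 , t-Θ) =
  a , b , n₀ ℕ.+ m , 0<a , 0<b , ℕ.>-nonZero (ℕₚ.m≤n⇒m≤n+o m (ℕ.>-nonZero⁻¹ n₀ {{n₀≢0}})) ,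
  λ n n₀+m≤n → begin
    b * fun t n        ≤⟨ *-monoˡ-≤-nonNeg b {{nonNegative (<⇒≤ 0<b)}}
                            (proj₂ (t-Θ n (ℕₚ.m+n≤o⇒m≤o n₀ n₀+m≤n))) ⟩
    b * (a * fun g n)  ≡⟨ *-assoc b a (fun g n) ⟨
    b * a * fun g n    ≡⟨ cong (_* fun g n) (*-comm b a) ⟩
    a * b * fun g n    ≡⟨ *-assoc a b (fun g n) ⟩
    a * (b * fun g n)  ≤⟨ *-monoˡ-≤-nonNeg a {{nonNegative (<⇒≤ 0<a)}}
                            (proj₁ (s-Θ n (ℕₚ.m+n≤o⇒n≤o n₀ n₀+m≤n))) ⟩
    a * fun s n        ∎
  where open ≤-Reasoning

bounded-linear-not-Θ : ∀ g s t {K ε} → 0ℚ < ε →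
                       (∀ n .{{_ : NonZero n}} → fun s n ≤ K) →
                       (∀ n .{{_ : NonZero n}} → n · ε ≤ fun t n) →
                       Θ g s → ¬ Θ g t
bounded-linear-not-Θ g s t {K} {ε} 0<ε s≤K nε≤t s∈Θ t∈Θ =
  let a , b , n₀ , 0<a , 0<b , n₀≢0 , bt≤as = Θ-comparable g s t s∈Θ t∈Θ
      0<bε = *-pos 0<b 0<ε
      N , aK<Nbε = archimedean 0<bε (a * K)
      -- The sum lies past the threshold `n₀`, is at least `N`, and is nonzero because `n₀` is.
      n = n₀ ℕ.+ N
      instance
        n≢0 : NonZero n
        n≢0 = ℕ.>-nonZero (ℕₚ.m≤n⇒m≤n+o N (ℕ.>-nonZero⁻¹ n₀ {{n₀≢0}}))
  in <-irrefl refl (begin-strict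
    a * K          <⟨ aK<Nbε ⟩
    N · (b * ε)    ≤⟨ ·-monoˡ-≤ (<⇒≤ 0<bε) (ℕₚ.m≤n+m N n₀) ⟩
    n · (b * ε)    ≡⟨ ×-comm-* n b ε ⟨
    b * (n · ε)    ≤⟨ *-monoˡ-≤-nonNeg b {{nonNegative (<⇒≤ 0<b)}} (nε≤t n) ⟩
    b * fun t n    ≤⟨ bt≤as n (ℕₚ.m≤m+n n₀ N) ⟩
    a * fun s n    ≤⟨ *-monoˡ-≤-nonNeg a {{nonNegative (<⇒≤ 0<a)}} (s≤K n) ⟩
    a * K          ∎)
  where open ≤-Reasoning

-- The final `halt` counts too, so this is the number of cost terms summed in `runTime`, whatever
-- the cost model.
steps : ∀ {P c d} → P ⊢ c ⇓ d → ℕ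
steps (stop _)   = 1
steps (step _ r) = suc (steps r)

module _ (κ : CostModel) where

  open CostModel κ

  steps·lower≤runTime : ∀ {P c d} (r : P ⊢ c ⇓ d) → steps r · lower ≤ runTime r
  steps·lower≤runTime (stop _)   = ≤-trans (≤-reflexive (+-identityʳ lower)) (lower≤cost _ _)
  steps·lower≤runTime (step _ r) = +-mono-≤ (lower≤cost _ _) (steps·lower≤runTime r)

  runTime≤steps·upper : ∀ {P c d} (r : P ⊢ c ⇓ d) → runTime r ≤ steps r · upper
  runTime≤steps·upper (stop _)   = ≤-trans (cost≤upper _ _) (≤-reflexive (sym (+-identityʳ upper)))
  runTime≤steps·upper (step _ r) = +-mono-≤ (cost≤upper _ _) (runTime≤steps·upper r)

cells-lookup : ∀ xs j → cells xs (toℕ j) ≡ lookup xs j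
cells-lookup (x ∷ xs) zero    = refl
cells-lookup (x ∷ xs) (suc j) = cells-lookup xs j

-- Input and output share one format, so `initial xs` already presents the answer `xs`.
copy : Algorithm
copy = record
  { problem = record
    { Instance = λ n xs → length xs ≡ n
    ; nonEmpty = λ n → replicate n 0ℤ , length-replicate n
    ; Solution = λ n xs ys → ys ≡ xs
    }
  ; program = []
  ; solves  = λ n xs _ → initial xs , stop refl , xs , (refl , cells-lookup xs) , refl
  }

copy-homogeneous : ∀ κ → Homogeneous κ copy
copy-homogeneous κ =
  record { fun = λ _ → 1ℚ ; positive = λ _ → positive⁻¹ 1ℚ } ,
  λ {t} (i , t≡time) →
    -- Every run is a single `halt`, so the cost bounds themselves are the constants, valid from
    -- dimension 1.
    upper , lower , 1 , 0<upper , 0<lower , _ ,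
    λ n _ →
      ≤-trans (≤-reflexive (*-identityʳ lower))
        (subst (lower ≤_) (sym (t≡time n)) (lower≤cost _ _)) ,
      ≤-trans (subst (_≤ upper) (sym (t≡time n)) (cost≤upper _ _))
        (≤-reflexive (sym (*-identityʳ upper)))
  where
  open CostModel κ
  0<upper : 0ℚ < upper
  0<upper = <-≤-trans (0<cost halt (initial [])) (cost≤upper halt (initial []))

-- Register 2 is never written and keeps its initial value 0.

countdown : Program
countdown =
  const 1 1ℤ ∷
  branch eq 0 2 4 ∷
  arith sub 0 0 1 ∷
  jump 1 ∷
  []

-- Induction on the counter; the hypotheses are the loop invariant at label 1. The run is returned
-- with its step count because `clear` needs its time, not just termination.
countdown-loop : ∀ k {stk ρ m} → ρ 0 ≡ + k → ρ 1 ≡ 1ℤ → ρ 2 ≡ 0ℤ →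
                 ∃[ d ] Σ[ r ∈ countdown ⊢ config 1 stk ρ m ⇓ d ]
                   reg d 0 ≡ 0ℤ × k ℕ.≤ steps r
countdown-loop zero {stk} {ρ} {m} ρ0 ρ1 ρ2 =
  -- Label 4 is just past the last instruction, where `fetch` yields `halt`.
  config 4 stk ρ m ,
  step (cong₂ (λ x y → goto (if compare eq x y then 4 else 2) (config 1 stk ρ m)) ρ0 ρ2)
    (stop refl) ,
  ρ0 , z≤n
countdown-loop (suc k) {stk} {ρ} {m} ρ0 ρ1 ρ2 =
  let d , r , d0 , k≤steps =
        -- `+ suc k ℤ.- 1ℤ` computes to `+ k`, and the update leaves registers 1 and 2 alone.
        countdown-loop k {ρ = ρ [ 0 ≔ ρ 0 ℤ.- ρ 1 ]} (cong₂ ℤ._-_ ρ0 ρ1) ρ1 ρ2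
  in d ,
     step (cong₂ (λ x y → goto (if compare eq x y then 4 else 2) (config 1 stk ρ m)) ρ0 ρ2)
       (step refl (step refl r)) ,
     d0 , s≤s (ℕₚ.m≤n⇒m≤o+n 2 k≤steps)

countdown-run : ∀ xs → ∃[ d ] Σ[ r ∈ countdown ⊢ initial xs ⇓ d ]
                  reg d 0 ≡ 0ℤ × length xs ℕ.≤ steps r
countdown-run xs =
  let d , r , d0 , k≤steps = countdown-loop (length xs) refl refl refl
  in d , step refl r , d0 , ℕₚ.m≤n⇒m≤1+n k≤steps

-- Allowing every length up to `n` puts a shortest and a longest input in each dimension. A zero in
-- register 0 is the length of the empty output.
clear : Algorithm
clear = record
  { problem = record
    { Instance = λ n xs → length xs ℕ.≤ n
    ; nonEmpty = λ n → [] , z≤n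
    ; Solution = λ n xs ys → ys ≡ []
    }
  ; program = countdown
  ; solves  = λ n xs _ →
      let d , r , d0 , _ = countdown-run xs in d , r , [] , (d0 , λ ()) , refl
  }

clear-nonHomogeneous : ∀ κ → NonHomogeneous κ clear
clear-nonHomogeneous κ (g , S⊆Θg) =
  bounded-linear-not-Θ g fastest slowest 0<lower
    -- The bound `K` is `steps (run []) · upper`, the same for every `n`.
    (λ n → runTime≤steps·upper κ (run []))
    (λ n → ≤-trans
      (·-monoˡ-≤ (<⇒≤ 0<lower)
        (subst (ℕ._≤ steps (run (replicate n 0ℤ))) (length-replicate n)
          (proj₂ (proj₂ (proj₂ (countdown-run (replicate n 0ℤ)))))))
      (steps·lower≤runTime κ (run (replicate n 0ℤ))))
    (S⊆Θg {fastest} (shortest , λ n → refl))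
    (S⊆Θg {slowest} (longest , λ n → refl))
  where
  open CostModel κ
  -- These are the runs that `solves` selects in `clear`, so the times of `fastest` and `slowest`
  -- unfold to their `runTime`.
  run : ∀ xs → countdown ⊢ initial xs ⇓ proj₁ (countdown-run xs)
  run xs = proj₁ (proj₂ (countdown-run xs))
  shortest longest : ∀ n → .{{_ : NonZero n}} → ∃ (Algorithm.Instance clear n)
  shortest n = [] , z≤n
  longest  n = replicate n 0ℤ , ℕₚ.≤-reflexive (length-replicate n)
  fastest slowest : PositiveFunction
  fastest = timeFunction κ clear shortest
  slowest = timeFunction κ clear longest

theorem3 : (κ : CostModel) →
    ((Homogeneous κ ∩ NonHomogeneous κ) ≐ ∅) ×
    (ExcludedMiddle 0ℓ → (Homogeneous κ ∪ NonHomogeneous κ) ≐ U) ×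
    Satisfiable (Homogeneous κ) ×
    Satisfiable (NonHomogeneous κ)
theorem3 κ =
  ((λ (h , ¬h) → ¬h h) , λ ()) ,
  (λ em → _ , λ _ → toSum em) ,
  (copy , copy-homogeneous κ) ,
  (clear , clear-nonHomogeneous κ)
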